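{- Let $(\mathcal{I},\gamma)$ be an inference system with coaxioms on a universe $\mathcal{U}$, and let $j\in\mathcal{U}$ be a judgement. Then the following are equivalent: (1) $j\in\mathit{Gen}(\mathcal{I},\gamma)$; (2) there exists a proof tree $t$ for $j$ in $\mathcal{I}$ such that each node of $t$ has an approximated proof tree of level $n$ in $(\mathcal{I},\gamma)$, for all $n\in\mathbb{N}$ (i.e. for each $\alpha\in\mathit{dom}(t)$ and each $n\in\mathbb{N}$ there is a tree in $\mathcal{T}_n$ with root $t(\alpha)$).
   Context: Inference systems. Fix a set $\mathcal{U}$ (the universe), whose elements are called judgements. An inference system $\mathcal{I}$ is a set of rules, i.e. pairs $\frac{Pr}{c}$ with $Pr\subseteq\mathcal{U}$ (premises, an arbitrary set) and $c\in\mathcal{U}$ (conclusion). Its inference operator is $F_{\mathcal{I}}:\wp(\mathcal{U})\to\wp(\mathcal{U})$, $F_{\mathcal{I}}(S)=\{c \mid \exists \frac{Pr}{c}\in\mathcal{I},\ Pr\subseteq S\}$. $\mathit{Ind}(\mathcal{I})$ and $\mathit{CoInd}(\mathcal{I})$ are the least and the greatest fixed point of $F_{\mathcal{I}}$. An inference system with coaxioms is a pair $(\mathcal{I},\gamma)$ with $\mathcal{I}$ an inference system and $\gamma\subseteq\mathcal{U}$. $\mathcal{I}_{\sqcup\gamma}=\mathcal{I}\cup\{\frac{\emptyset}{c}\mid c\in\gamma\}$; for $S\subseteq\mathcal{U}$, $\mathcal{I}_{\sqcap S}=\{\frac{Pr}{c}\in\mathcal{I}\mid c\in S\}$. The interpretation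 generated by coaxioms is $\mathit{Gen}(\mathcal{I},\gamma)=\mathit{CoInd}(\mathcal{I}_{\sqcap \mathit{Ind}(\mathcal{I}_{\sqcup\gamma})})$. Trees. For a set $A$, $A^\star$ is the set of finite strings over $A$, $\varepsilon$ the empty string. A tree language is a non-empty $L\subseteq A^\star$ such that $\alpha a\in L$ implies $\alpha\in L$ ($a\in A$). A tree labelled in a set $\Lambda$ is a function $t:L\to\Lambda$ with $L=\mathit{dom}(t)$ a tree language; its root is $t(\varepsilon)$; its nodes are the elements of $\mathit{dom}(t)$. For $\alpha\in\mathit{dom}(t)$, $\mathit{chl}_t(\alpha)=\{\alpha a\in \mathit{dom}(t)\mid a\in A\}$. $t$ is well-founded if every subset of $\mathit{dom}(t)$ that is a chain for the prefix order is finite. $t$ is children injective if $t$ restricted to $\mathit{chl}_t(\alpha)$ is injective for all $\alpha\in\mathit{dom}(t)$. Children injective trees labelled in $\Lambda$ are considered up to renaming of alphabet symbols and can be taken in canonical form: $A=\Lambda$ and $t(\alpha a)=a$ for all $\alpha a\in\mathit{dom}(t)$. Proof trees. A proof tree in $\mathcal{I}$ is a children injective tree $t$ labelled in $\mathcal{U}$ such that for all $\alpha\in\mathit{dom}(t)$ there is a rule $\frac{Pr}{c}\in\mathcal{I}$ with $t(\alpha)=c$ and $t(\mathit{chl}_t(\alpha))=Pr$. It is a proof tree for $j$ if $t(\varepsilon)=j$. The sets $\mathcal{T}_n$ of approximated proof trees of level $n$ in $(\mathcal{I},\gamma)$ are defined inductively: $\mathcal{T}_0$ is the set of well-founded proof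 trees in $\mathcal{I}_{\sqcup\gamma}$; $\mathcal{T}_{n+1}$ consists of the trees with root $c$ whose direct subtrees are exactly the members of a family $(t_i)_{i\in Pr}$, where $\frac{Pr}{c}\in\mathcal{I}$ and, for each $i\in Pr$, $t_i\in\mathcal{T}_n$ and $t_i(\varepsilon)=i$. -}

module Defs where

open import Axiom.ExcludedMiddle using (ExcludedMiddle)
open import Data.List.Base using (List; []; _∷_; _∷ʳ_; [_])
open import Data.List.Relation.Binary.Prefix.Heterogeneous using (Prefix)
open import Data.List.Reverse using (Reverse; []; _∶_∶ʳ_; reverseView)
import Data.List.Membership.Propositional as List
open import Data.Nat.Base using (ℕ; zero; suc)
open import Data.Product.Base using (Σ; ∃; _×_; _,_; proj₁; proj₂)
open import Data.Sum.Base using (_⊎_; inj₁; inj₂)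
open import Function.Bundles using (_⇔_)
open import Level using (Level; Lift; lift; lower; _⊔_) renaming (suc to lsuc)
open import Relation.Binary.PropositionalEquality using (_≡_; refl)
open import Relation.Nullary.Decidable using (True; toWitness; fromWitness)
open import Relation.Unary using (Pred; _∈_; _⊆_; _≐_; ∅; Satisfiable)

private
  variable
    ℓ s : Level

------------------------------------------------------------------------
-- Fixed points of operators on subsets

IsLeastFixedPoint : {U : Set ℓ} → (Pred U s → Pred U s) → Pred U s → Set (ℓ ⊔ lsuc s)
IsLeastFixedPoint F X = (F X ≐ X) × (∀ Y → F Y ≐ Y → X ⊆ Y)

IsGreatestFixedPoint : {U : Set ℓ} → (Pred U s → Pred U s) → Pred U s → Set (ℓ ⊔ lsuc s)
IsGreatestFixedPoint F X = (F X ≐ X) × (∀ Y → F Y ≐ Y → Y ⊆ X)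

------------------------------------------------------------------------
-- Inference systems

-- The premises of a rule form an arbitrary subset of U.  A set of rules
-- lives one level up, so that the interpretations below, which quantify
-- over premise sets, can be used in forming new inference systems.

InferenceSystem : Set ℓ → Set (lsuc (lsuc ℓ))
InferenceSystem {ℓ} U = Pred (Pred U ℓ × U) (lsuc ℓ)

module _ {U : Set ℓ} where

  -- Level-polymorphic in S; at s = lsuc ℓ it is an endo-operator.

  F : InferenceSystem U → Pred U s → Pred U (lsuc ℓ ⊔ s)
  F I S c = Σ (Pred U ℓ) λ Pr → ((Pr , c) ∈ I) × (Pr ⊆ S)

  data Ind (I : InferenceSystem U) : Pred U (lsuc ℓ) where
    fold : F I (Ind I) ⊆ Ind I

  -- Union of the consistent sets (Knaster–Tarski).  Ranging over S at
  -- level ℓ loses nothing classically: see CoInd-isGreatestFixedPoint.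

  CoInd : InferenceSystem U → Pred U (lsuc ℓ)
  CoInd I c = Σ (Pred U ℓ) λ S → (S ⊆ F I S) × (c ∈ S)

  Ind-isLeastFixedPoint : (I : InferenceSystem U) → IsLeastFixedPoint (F I) (Ind I)
  Ind-isLeastFixedPoint I = (fold , λ { (fold x) → x }) , λ Y FY≐Y → least Y (proj₁ FY≐Y)
    where
    least : ∀ Y → F I Y ⊆ Y → Ind I ⊆ Y
    least Y closed (fold (Pr , r , Pr⊆)) = closed (Pr , r , λ p → least Y closed (Pr⊆ p))

  CoInd-isGreatestFixedPoint : ExcludedMiddle (lsuc ℓ) → (I : InferenceSystem U) →
                               IsGreatestFixedPoint (F I) (CoInd I)
  CoInd-isGreatestFixedPoint em I = (in-CoInd , out-CoInd) , greatest
    where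
    out-CoInd : CoInd I ⊆ F I (CoInd I)
    out-CoInd (S , S⊆FS , c∈S) with S⊆FS c∈S
    ... | Pr , r , Pr⊆S = Pr , r , λ p → S , S⊆FS , Pr⊆S p

    in-CoInd : F I (CoInd I) ⊆ CoInd I
    in-CoInd {c} (Pr , r , Pr⊆) = S , consistent , inj₁ refl
      where
      S : Pred U ℓ
      S u = (u ≡ c) ⊎ Σ U λ i → Σ (i ∈ Pr) λ p → u ∈ proj₁ (Pr⊆ p)

      consistent : S ⊆ F I S
      consistent (inj₁ refl) = Pr , r , λ p → inj₂ (_ , p , proj₂ (proj₂ (Pr⊆ p)))
      consistent (inj₂ (i , p , u∈)) with proj₁ (proj₂ (Pr⊆ p)) u∈
      ... | Pr′ , r′ , Pr′⊆ = Pr′ , r′ , λ q → inj₂ (i , p , Pr′⊆ q)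

    greatest : ∀ Y → F I Y ≐ Y → Y ⊆ CoInd I
    greatest Y (_ , Y⊆FY) y = S , consistent , lift (fromWitness y)
      where
      S : Pred U ℓ
      S u = Lift ℓ (True (em {P = u ∈ Y}))

      consistent : S ⊆ F I S
      consistent x with Y⊆FY (toWitness (lower x))
      ... | Pr , r , Pr⊆Y = Pr , r , λ p → lift (fromWitness (Pr⊆Y p))

  infixl 6 _⊔ᶜ_ _⊓ᶜ_

  _⊔ᶜ_ : InferenceSystem U → Pred U ℓ → InferenceSystem U
  (I ⊔ᶜ γ) (Pr , c) = ((Pr , c) ∈ I) ⊎ ((Pr ≐ ∅) × (c ∈ γ))

  _⊓ᶜ_ : InferenceSystem U → Pred U (lsuc ℓ) → InferenceSystem U
  (I ⊓ᶜ S) (Pr , c) = ((Pr , c) ∈ I) × (c ∈ S)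

  Gen : InferenceSystem U → Pred U ℓ → Pred U (lsuc ℓ)
  Gen I γ = CoInd (I ⊓ᶜ Ind (I ⊔ᶜ γ))

------------------------------------------------------------------------
-- Trees

record IsTreeLanguage {A : Set ℓ} (L : Pred (List A) ℓ) : Set ℓ where
  field
    nonEmpty     : Satisfiable L
    prefixClosed : ∀ α a → (α ∷ʳ a) ∈ L → α ∈ L

  ε∈ : [] ∈ L
  ε∈ = go (reverseView (proj₁ nonEmpty)) (proj₂ nonEmpty)
    where
    go : ∀ {α} → Reverse α → α ∈ L → [] ∈ L
    go []             p = p
    go (α ∶ rs ∶ʳ a) p = go rs (prefixClosed α a p)

-- label-unique: the label depends on the node only, not on the proof
-- that it belongs to the domain.

record Tree (A Λ : Set ℓ) : Set (lsuc ℓ) where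
  field
    dom            : Pred (List A) ℓ
    isTreeLanguage : IsTreeLanguage dom
    label          : ∀ {α} → α ∈ dom → Λ
    label-unique   : ∀ {α} (p q : α ∈ dom) → label p ≡ label q

  open IsTreeLanguage isTreeLanguage public

  root : Λ
  root = label ε∈

  chl : List A → Pred (List A) ℓ
  chl α β = (β ∈ dom) × ∃ λ a → β ≡ α ∷ʳ a

  image : Pred (List A) ℓ → Pred Λ ℓ
  image X b = ∃ λ α → Σ (α ∈ dom) λ p → (α ∈ X) × (label p ≡ b)

  subtree : ∀ {a} → [ a ] ∈ dom → Tree A Λ
  subtree {a} q = record
    { dom            = λ α → (a ∷ α) ∈ dom
    ; isTreeLanguage = record
      { nonEmpty     = [] , q
      ; prefixClosed = λ α b → prefixClosed (a ∷ α) b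
      }
    ; label          = label
    ; label-unique   = label-unique
    }

open Tree

module _ {A Λ : Set ℓ} where

  infix 4 _≈_

  -- Extensional equality of partial functions.

  _≈_ : Tree A Λ → Tree A Λ → Set ℓ
  t ≈ t′ = (dom t ≐ dom t′) ×
           (∀ {α} (p : α ∈ dom t) (q : α ∈ dom t′) → label t p ≡ label t′ q)

  ChildrenInjective : Tree A Λ → Set ℓ
  ChildrenInjective t = ∀ {α} → α ∈ dom t →
    ∀ {β β′} (p : β ∈ dom t) (q : β′ ∈ dom t) →
    β ∈ chl t α → β′ ∈ chl t α → label t p ≡ label t q → β ≡ β′

  _⊑_ : List A → List A → Set ℓ
  _⊑_ = Prefix _≡_

  Chain : Pred (List A) ℓ → Set ℓ
  Chain C = ∀ {α β} → α ∈ C → β ∈ C → (α ⊑ β) ⊎ (β ⊑ α)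

  Finite : Pred (List A) ℓ → Set ℓ
  Finite C = ∃ λ αs → C ≐ (List._∈ αs)

  WellFounded : Tree A Λ → Set (lsuc ℓ)
  WellFounded t = (C : Pred (List A) ℓ) → C ⊆ dom t → Chain C → Finite C

Canonical : {Λ : Set ℓ} → Tree Λ Λ → Set ℓ
Canonical t = ∀ α a (p : (α ∷ʳ a) ∈ dom t) → label t p ≡ a

------------------------------------------------------------------------
-- Proof trees

-- Children injective trees are identified up to renaming of the alphabet;
-- they are represented here by their canonical forms, over the alphabet U.

module _ {U : Set ℓ} where

  record IsProofTree (I : InferenceSystem U) (t : Tree U U) : Set (lsuc ℓ) where
    field
      childrenInjective : ChildrenInjective t
      canonical         : Canonical t
      rule              : ∀ {α} (p : α ∈ dom t) →
        ∃ λ Pr → ((Pr , label t p) ∈ I) × (image t (chl t α) ≐ Pr)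

  -- In canonical form the direct subtree whose root is i is the one
  -- hanging at the symbol i.

  DirectSubtrees : Tree U U → (Pr : Pred U ℓ) → (∀ {i} → i ∈ Pr → Tree U U) → Set ℓ
  DirectSubtrees t Pr ts =
    (∀ i → ([ i ] ∈ dom t) ⇔ (i ∈ Pr)) ×
    (∀ {i} (q : [ i ] ∈ dom t) (p : i ∈ Pr) → subtree t q ≈ ts p)

  𝒯 : InferenceSystem U → Pred U ℓ → ℕ → Pred (Tree U U) (lsuc ℓ)
  𝒯 I γ zero    t = WellFounded t × IsProofTree (I ⊔ᶜ γ) t
  𝒯 I γ (suc n) t = Canonical t ×
    Σ (Pred U ℓ) λ Pr → ((Pr , root t) ∈ I) ×
    Σ (∀ {i} → i ∈ Pr → Tree U U) λ ts →
      (∀ {i} (p : i ∈ Pr) → (ts p ∈ 𝒯 I γ n) × (root (ts p) ≡ i)) ×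
      DirectSubtrees t Pr ts

{-# OPTIONS --safe #-}

-- The trees of (1) ⇒ (2) are unfoldings of a family X with X ⊆ F I X.  Unfolding a consistent
-- set gives the proof tree of (2), unfolding Ind (I ⊔ᶜ γ) gives well-founded trees, and
-- unfolding the iterates Fⁿ (Ind (I ⊔ᶜ γ)), which all contain the consistent set, gives
-- approximated proof trees of level n.  Conversely, the labels of a proof tree in I form a
-- consistent set, which lies in Ind (I ⊔ᶜ γ) by the case n = 0 of (2): a proof tree whose root
-- is not derivable has an infinite path of nodes with non-derivable labels.

module Submission where

open import Defs
open import Axiom.ExcludedMiddle using (ExcludedMiddle)
open import Data.Empty using (⊥)
open import Data.List.Base using (List; []; _∷_; _∷ʳ_; [_]; foldl; filter; length; map)
import Data.List.Membership.Propositional as List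
open import Data.List.Membership.Propositional.Properties using (∈-filter⁺; ∈-filter⁻; ∈-map⁺; finite)
open import Data.List.Properties using (foldl-∷ʳ; length-++)
open import Data.List.Relation.Binary.Pointwise using () renaming (refl to Pointwise-refl)
open import Data.List.Relation.Binary.Prefix.Heterogeneous using (Prefix; []; _∷_; tail)
open import Data.List.Relation.Binary.Prefix.Heterogeneous.Properties using (fromPointwise)
open import Data.List.Relation.Unary.Any using (here; there)
open import Data.Nat.Base using (ℕ; zero; suc; _≤′_; ≤′-refl; ≤′-step)
open import Data.Nat.Properties using (≤-total; ≤⇒≤′; +-comm)
open import Data.Product.Base using (Σ; ∃; _×_; _,_; proj₁; proj₂)
open import Data.Sum.Base using (inj₁; inj₂) renaming (map to map-⊎)
open import Data.Unit.Polymorphic.Base using (⊤; tt)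
open import Function.Base using (_∘_; case_of_)
open import Function.Bundles using (_⇔_; mk⇔; mk↣)
open import Level using (Level; Lift; lift; lower) renaming (suc to lsuc)
open import Relation.Binary.PropositionalEquality using (_≡_; refl; sym; trans; cong; subst)
open import Relation.Nullary using (yes; no; contradiction)
open import Relation.Nullary.Decidable using (map′; recompute; decidable-stable)
open import Relation.Unary using (Pred; _∈_; _∉_; _⊆_)

private
  variable
    ℓ s : Level

open Tree

lower-em : ExcludedMiddle (lsuc ℓ) → ExcludedMiddle ℓ
lower-em {ℓ} em = map′ lower lift (em {P = Lift (lsuc ℓ) _})

Prefix-∷ʳ : {A : Set ℓ} {α β : List A} (a : A) → Prefix _≡_ α β → Prefix _≡_ α (β ∷ʳ a)
Prefix-∷ʳ a []      = []
Prefix-∷ʳ a (e ∷ p) = e ∷ Prefix-∷ʳ a p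

-- In canonical form a node carries its last symbol as label; the first argument is the label of the
-- root.
lastLabel : {U : Set ℓ} → U → List U → U
lastLabel = foldl (λ _ a → a)

canonical⇒childrenInjective : {U : Set ℓ} (t : Tree U U) → Canonical t → ChildrenInjective t
canonical⇒childrenInjective t canonical {α} _ p q (_ , a , refl) (_ , b , refl) eq =
  cong (α ∷ʳ_) (trans (sym (canonical α a p)) (trans eq (canonical α b q)))

-- `Finite` asks for a list of exactly the members of `C`, so `αs` is filtered, with excluded middle
-- deciding membership in `C`.
⊆-finite : {A : Set ℓ} → ExcludedMiddle ℓ → {C : Pred (List A) ℓ} (αs : List (List A)) →
           C ⊆ (List._∈ αs) → Finite {Λ = A} C
⊆-finite em αs C⊆ =
  filter dec αs , (λ c → ∈-filter⁺ dec (C⊆ c) c) , (λ m → proj₂ (∈-filter⁻ dec {xs = αs} m))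
  where dec = λ _ → em

module Unfold {U : Set ℓ} (em : ExcludedMiddle ℓ) {I : InferenceSystem U} {X : Pred U s}
              (X⊆FX : X ⊆ F I X) where

  -- The rule at a node is read off the proof that its label lies in `X`, so equal labels may be
  -- expanded differently. For `Ind` the unfolding thus follows the given derivation.
  Premises : ∀ {c} → c ∈ X → Pred U ℓ
  Premises x = proj₁ (X⊆FX x)

  -- Irrelevance in the second argument is needed because all proofs that a is a premise
  -- stand for the same node of the tree.

  next : ∀ {c a} (x : c ∈ X) → .(a ∈ Premises x) → a ∈ X
  next x q = proj₂ (proj₂ (X⊆FX x)) (recompute em q)

  Path : ∀ {c} → c ∈ X → Pred (List U) ℓ
  Path x []      = ⊤
  Path x (a ∷ α) = Σ (a ∈ Premises x) λ q → Path (next x q) α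

  Path-init : ∀ {c} (x : c ∈ X) α {a} → (α ∷ʳ a) ∈ Path x → α ∈ Path x
  Path-init x []      _       = tt
  Path-init x (b ∷ α) (q , p) = q , Path-init (next x q) α p

  end : ∀ {c} (x : c ∈ X) {α} → α ∈ Path x → lastLabel c α ∈ X
  end x {[]}    _       = x
  end x {a ∷ α} (q , p) = end (next x q) {α} p

  Path-∷ʳ : ∀ {c} (x : c ∈ X) {α a} (p : α ∈ Path x) →
            a ∈ Premises (end x {α} p) → (α ∷ʳ a) ∈ Path x
  Path-∷ʳ x {[]}    _       q  = q , tt
  Path-∷ʳ x {b ∷ α} (q , p) q′ = q , Path-∷ʳ (next x q) {α} p q′

  Path-last : ∀ {c} (x : c ∈ X) {α a} (p : α ∈ Path x) →
              (α ∷ʳ a) ∈ Path x → a ∈ Premises (end x {α} p)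
  Path-last x {[]}    _       (q , _)  = q
  Path-last x {b ∷ α} (q , p) (_ , p′) = Path-last (next x q) {α} p p′

  unfold : ∀ {c} → c ∈ X → Tree U U
  unfold {c} x = record
    { dom            = Path x
    ; isTreeLanguage = record
      { nonEmpty     = [] , tt
      ; prefixClosed = λ α a → Path-init x α
      }
    ; label          = λ {α} _ → lastLabel c α
    ; label-unique   = λ _ _ → refl
    }

  unfold-canonical : ∀ {c} (x : c ∈ X) → Canonical (unfold x)
  unfold-canonical {c} x α a _ = foldl-∷ʳ _ c a α

  unfold-isProofTree : ∀ {c} (x : c ∈ X) → IsProofTree I (unfold x)
  unfold-isProofTree {c} x = record
    { childrenInjective = canonical⇒childrenInjective (unfold x) (unfold-canonical x)
    ; canonical         = unfold-canonical x
    ; rule              = λ {α} p →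
        Premises (end x {α} p) , proj₁ (proj₂ (X⊆FX (end x {α} p))) ,
        (λ { (_ , p′ , (_ , a , refl) , refl) →
               subst (_∈ Premises (end x {α} p)) (sym (foldl-∷ʳ _ c a α))
                     (Path-last x {α} p p′) }) ,
        (λ {a} q → let p′ = Path-∷ʳ x {α} p q in
           α ∷ʳ a , p′ , (p′ , a , refl) , foldl-∷ʳ _ c a α)
    }

  -- Comparable non-empty strings share their first symbol, so a chain lies, up to the empty string,
  -- in a single direct subtree.
  unfold-wellFounded : ∀ {c} (x : c ∈ X) →
    (∀ {a} (q : a ∈ Premises x) → WellFounded (unfold (next x q))) → WellFounded (unfold x)
  unfold-wellFounded x wf C C⊆ chain with em {P = ∃ λ a → ∃ λ α → (a ∷ α) ∈ C}
  ... | no none = ⊆-finite em [ [] ] λ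
    { {[]}    _ → here refl
    ; {a ∷ α} m → contradiction (a , α , m) none
    }
  ... | yes (a , α , m) with wf (proj₁ (C⊆ m)) (C ∘ (a ∷_)) (proj₂ ∘ C⊆)
                               (λ u v → map-⊎ tail tail (chain u v))
  ...   | αs , C⊆αs , _ = ⊆-finite em ([] ∷ map (a ∷_) αs) covered
    where
    covered : C ⊆ (List._∈ ([] ∷ map (a ∷_) αs))
    covered {[]}    _ = here refl
    covered {b ∷ β} v with chain m v
    ... | inj₁ (refl ∷ _) = there (∈-map⁺ (a ∷_) (C⊆αs v))
    ... | inj₂ (refl ∷ _) = there (∈-map⁺ (a ∷_) (C⊆αs v))

module _ {A Λ : Set ℓ} (t : Tree A Λ) (Q : ∀ {α} → α ∈ dom t → Set s) where

  Node : Set _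
  Node = ∃ λ α → Σ (α ∈ dom t) Q

  -- Iterating the step gives nested nodes, the `n`-th of length `n`. They form a chain into which ℕ
  -- injects, so no list can enumerate it.
  wellFounded⇒noInfinitePath : WellFounded t →
    Q (ε∈ t) → (∀ {α} (p : α ∈ dom t) → Q p →
      ∃ λ a → Σ ((α ∷ʳ a) ∈ dom t) Q) → ⊥
  wellFounded⇒noInfinitePath wf start step =
    finite (mk↣ {to = path} injective) αs (λ n → C⊆αs (n , refl))
    where
    node : ℕ → Node
    node zero    = [] , ε∈ t , start
    node (suc n) with node n
    ... | α , p , q with step p q
    ...   | a , p′ , q′ = α ∷ʳ a , p′ , q′

    path : ℕ → List A
    path = proj₁ ∘ node

    C : Pred (List A) ℓ
    C α = ∃ λ n → path n ≡ α

    length-path : ∀ n → length (path n) ≡ n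
    length-path zero    = refl
    length-path (suc n) =
      trans (length-++ (path n)) (trans (+-comm _ 1) (cong suc (length-path n)))

    injective : ∀ {m n} → path m ≡ path n → m ≡ n
    injective {m} {n} eq = trans (sym (length-path m)) (trans (cong length eq) (length-path n))

    path-mono : ∀ {m n} → m ≤′ n → Prefix _≡_ (path m) (path n)
    path-mono ≤′-refl       = fromPointwise (Pointwise-refl refl)
    path-mono (≤′-step m≤n) = Prefix-∷ʳ _ (path-mono m≤n)

    chain : Chain {Λ = Λ} C
    chain (m , refl) (n , refl) =
      map-⊎ (path-mono ∘ ≤⇒≤′) (path-mono ∘ ≤⇒≤′) (≤-total m n)

    C-finite : Finite {Λ = Λ} C
    C-finite = wf C (λ { (n , refl) → proj₁ (proj₂ (node n)) }) chain

    αs = proj₁ C-finite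
    C⊆αs = proj₁ (proj₂ C-finite)

module _ {U : Set ℓ} (em : ExcludedMiddle (lsuc ℓ)) where

  wellFounded⇒root∈Ind : {I : InferenceSystem U} (t : Tree U U) →
    WellFounded t → IsProofTree I t → root t ∈ Ind I
  wellFounded⇒root∈Ind {I} t wf isProof = decidable-stable em λ root∉ →
    wellFounded⇒noInfinitePath t (λ p → label t p ∉ Ind I) wf root∉ step
    where
    open IsProofTree isProof

    step : ∀ {α} (p : α ∈ dom t) → label t p ∉ Ind I →
           ∃ λ a → Σ ((α ∷ʳ a) ∈ dom t) λ p′ → label t p′ ∉ Ind I
    -- If all children had derivable labels, the rule at this node would derive its own label.
    step {α} p p∉ = decidable-stable em λ none →
      let Pr , r , _ , Pr⊆ = rule p in
      p∉ (fold (Pr , r , λ u∈Pr → decidable-stable em λ u∉ →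
        case Pr⊆ u∈Pr of λ where
          (_ , p′ , (_ , a , refl) , refl) → none (a , p′ , u∉)))

module _ {U : Set ℓ} (I : InferenceSystem U) (γ : Pred U ℓ) where

  Approx : ℕ → Pred U (lsuc ℓ)
  Approx zero    = Ind (I ⊔ᶜ γ)
  Approx (suc n) = F I (Approx n)

  -- `Unfold` needs one fixed family, so all levels are joined. The level stored in the proof counts
  -- down along a path; from level 0 on, a derivation that may use coaxioms is followed.
  ApproxAtSomeLevel : Pred U (lsuc ℓ)
  ApproxAtSomeLevel c = ∃ λ n → c ∈ Approx n

  approx-consistent : ApproxAtSomeLevel ⊆ F (I ⊔ᶜ γ) ApproxAtSomeLevel
  approx-consistent (zero  , fold (Pr , r , Pr⊆)) = Pr , r , λ q → zero , Pr⊆ q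
  approx-consistent (suc n , Pr , r , Pr⊆)        = Pr , inj₁ r , λ q → n , Pr⊆ q

  -- Level 0 is the side condition that `⊓ᶜ` puts on conclusions; each further level applies the
  -- rule of `I` under which `S` is consistent.
  consistent⊆Approx : {S : Pred U s} → S ⊆ F (I ⊓ᶜ Ind (I ⊔ᶜ γ)) S → ∀ n → S ⊆ Approx n
  consistent⊆Approx S⊆FS zero    c∈S = proj₂ (proj₁ (proj₂ (S⊆FS c∈S)))
  consistent⊆Approx S⊆FS (suc n) c∈S with S⊆FS c∈S
  ... | Pr , (r , _) , Pr⊆S = Pr , r , consistent⊆Approx S⊆FS n ∘ Pr⊆S

  module _ (em : ExcludedMiddle ℓ) where

    open Unfold em approx-consistent

    -- By induction on the derivation. `next` goes on with a recomputed premise proof, so the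
    -- recursive call is made at that proof.
    unfold-Ind-wellFounded : ∀ {c} (x : c ∈ Ind (I ⊔ᶜ γ)) → WellFounded (unfold (zero , x))
    unfold-Ind-wellFounded (fold (Pr , r , Pr⊆)) =
      unfold-wellFounded _ λ q → unfold-Ind-wellFounded (Pr⊆ (recompute em q))

    unfold-∈𝒯 : ∀ n {c} (x : c ∈ Approx n) → unfold (n , x) ∈ 𝒯 I γ n
    unfold-∈𝒯 zero    x              = unfold-Ind-wellFounded x , unfold-isProofTree _
    unfold-∈𝒯 (suc n) (Pr , r , Pr⊆) =
      unfold-canonical (suc n , Pr , r , Pr⊆) , Pr , r ,
      (λ q → unfold (next (suc n , Pr , r , Pr⊆) q)) ,
      (λ q → unfold-∈𝒯 n (Pr⊆ (recompute em q)) , refl) ,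
      (λ i → mk⇔ proj₁ (_, tt)) ,
      -- The two domains differ only by the premise proof stored at the head, which `next` ignores.
      (λ q p → (proj₂ , (p ,_)) , λ _ _ → refl)

  labels⊆Gen : (t : Tree U U) → IsProofTree I t →
    (∀ {α} (p : α ∈ dom t) → label t p ∈ Ind (I ⊔ᶜ γ)) →
    ∀ {α} (p : α ∈ dom t) → label t p ∈ Gen I γ
  labels⊆Gen t isProof derivable p = Labels , consistent , (_ , p , refl)
    where
    -- Indexing by nodes keeps this set at level `ℓ`, as a witness for `CoInd` must be.
    Labels : Pred U ℓ
    Labels u = ∃ λ α → Σ (α ∈ dom t) λ p → label t p ≡ u

    consistent : Labels ⊆ F (I ⊓ᶜ Ind (I ⊔ᶜ γ)) Labels
    consistent (_ , p , refl) with IsProofTree.rule isProof p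
    ... | Pr , r , _ , Pr⊆ = Pr , (r , derivable p) , λ q → case Pr⊆ q of λ where
      (β , p′ , _ , eq) → β , p′ , eq

corollary4p11 : {ℓ : Level} → ExcludedMiddle (lsuc ℓ) →
    {U : Set ℓ} (I : InferenceSystem U) (γ : Pred U ℓ) (j : U) →
    (j ∈ Gen I γ) ⇔
    (∃ λ (t : Tree U U) → IsProofTree I t × (Tree.root t ≡ j) ×
      (∀ {α} (p : α ∈ Tree.dom t) n →
        ∃ λ (t′ : Tree U U) → (t′ ∈ 𝒯 I γ n) × (Tree.root t′ ≡ Tree.label t p)))
corollary4p11 em {U} I γ j = mk⇔ to from
  where
  em₀ = lower-em em

  to : j ∈ Gen I γ → _
  to (S , S⊆FS , j∈S) = unfold j∈S , unfold-isProofTree j∈S , refl , λ {α} p n →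
    -- `end` shows that the label of the node `α` is again in `S`, hence in every approximant.
    let x = consistent⊆Approx I γ S⊆FS n (end j∈S {α} p) in
    Unfold.unfold em₀ (approx-consistent I γ) (n , x) , unfold-∈𝒯 I γ em₀ n x , refl
    where
    S⊆F-I-S : S ⊆ F I S
    S⊆F-I-S c∈S with S⊆FS c∈S
    ... | Pr , (r , _) , Pr⊆S = Pr , r , Pr⊆S

    open Unfold em₀ S⊆F-I-S

  from : _ → j ∈ Gen I γ
  from (t , isProof , refl , approx) = labels⊆Gen I γ t isProof derivable (ε∈ t)
    where
    derivable : ∀ {α} (p : α ∈ dom t) → label t p ∈ Ind (I ⊔ᶜ γ)
    derivable p with approx p zero
    ... | t′ , (wf , isProof′) , eq =
      subst (_∈ Ind (I ⊔ᶜ γ)) eq (wellFounded⇒root∈Ind em t′ wf isProof′)
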